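{- Let $P$ be a non-contradictory extended logic program. Then $WFM(P) = A(P)$, i.e. the well-founded model of $P$ equals the set of literals $A(P)$ that are consequences of the argumentation semantics of $u/a$-justified arguments.
   Context: Extended logic programs. An objective literal is an atom $B$ or its explicit negation $\neg B$; $\neg\neg L = L$. A default literal is $not~L$ with $L$ an objective literal. An extended logic program $P$ is a (possibly infinite) set of (ground) rules $L_0 \gets L_1,\dots,L_m, not~L_{m+1},\dots,not~L_{m+n}$ with $m,n\ge 0$ and all $L_i$ objective literals; $L_0$ is the head, the right-hand side is the body. $\mathcal{H}(P)$ is the set of all objective literals of $P$ (Herbrand base). For a set $F$ of objective literals, $not~F = \{not~L \mid L\in F\}$. A pseudo-interpretation of $P$ is a set $T\cup not~F$ with $T,F\subseteq\mathcal{H}(P)$; it is an interpretation if $T\cap F=\emptyset$. Arguments. An argument for $P$ is a finite sequence $A=[r_1,\dots,r_n]$ of rules of $P$ such that for every $i$ and every objective literal $L$ in the body of $r_i$ there is $k>i$ with $head(r_k)=L$. A subargument of $A$ is a subsequence of $A$ that is an argument. $conc(A)$ is the set of heads of rules of $A$ (conclusions); $assm(A)$ is the set of default literals in bodies of rules of $A$ (assumptions). $A$ is minimal for $L\in conc(A)$ if no proper subargument of $A$ has conclusion $L$; $A$ is minimal if it is minimal for some $L$. $\mathit{Args}_P$ is the set of minimal arguments for $P$; all arguments below range over $\mathit{Args}_P$. An argument for $L$ is an argument with conclusion $L$. Attacks. $A_1$ undercuts $A_2$ ($u$) if there is an objective literal $L\in conc(A_1)$ with $not~L\in assm(A_2)$.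 $A_1$ rebuts $A_2$ if there is $L\in conc(A_1)$ with $\neg L\in conc(A_2)$. $A_1$ attacks $A_2$ ($a$) if it undercuts or rebuts $A_2$. Justified arguments. For a set $S$ of arguments, $A$ is $u/a$-acceptable wrt. $S$ if for every argument $B$ that undercuts $A$ there is $C\in S$ that attacks $B$. $J_{u/a}$ is the least fixpoint of the monotone operator $S\mapsto\{A \mid A \text{ is } u/a\text{ -acceptable wrt. } S\}$ on subsets of $\mathit{Args}_P$. An argument is justified if it is in $J_{u/a}$, and overruled if it is attacked by a justified argument. Define $A(P) = T\cup not~F$ where $T=\{L\in\mathcal{H}(P) \mid \text{there is a justified argument for } L\}$ and $F=\{L\in\mathcal{H}(P)\mid \text{all arguments for } L \text{ are overruled}\}$. Well-founded semantics. For a set $I$ of objective literals, $\Gamma_P I$ is defined as follows: treat each $\neg B$ as a new atom, delete from $P$ all rules whose body contains some $not~L$ with $L\in I$, delete all remaining default literals, and let $\Gamma_P I$ be the least model of the resulting definite program (new atoms translated back to explicit negations). The semi-normal version $P_s$ of $P$ is obtained by replacing every rule $L\gets Body$ by $L\gets not~\neg L, Body$. Write $\Gamma=\Gamma_P$, $\Gamma_s=\Gamma_{P_s}$. The operator $\Gamma\Gamma_s$ is monotone; let $T$ be its least fixpoint. The paraconsistent well-founded model is the pseudo-interpretation $WFM_p(P) = T\cup not~(\mathcal{H}(P)-\Gamma_s T)$. If $WFM_p(P)$ is an interpretation, $P$ is called non-contradictory and $WFM(P)=WFM_p(P)$ is called the well-founded model of $P$. -}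

module Defs where

open import Axiom.ExcludedMiddle using (ExcludedMiddle)
open import Data.Fin as Fin using (Fin)
open import Data.List using (List; []; _∷_; _++_; map; length; lookup)
open import Data.List.Membership.Propositional using () renaming (_∈_ to _∈ˡ_)
open import Data.List.Relation.Binary.Sublist.Propositional using ()
  renaming (_⊂_ to _⊏_)
open import Data.List.Relation.Unary.All using (All; []; _∷_)
open import Data.List.Relation.Unary.Any as Any using (Any)
open import Data.Product using (Σ-syntax; ∃-syntax; _×_; _,_; proj₁)
open import Data.Sum using (_⊎_)
open import Function using (_∘_; _on_)
open import Level using (0ℓ) renaming (suc to lsuc)
open import Relation.Binary using (Rel)
open import Relation.Binary.PropositionalEquality using (_≡_)
open import Relation.Nullary using (¬_)
open import Relation.Nullary.Decidable using (True; toWitness; fromWitness)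
open import Relation.Unary using (Pred; _∈_; _∉_; _⊆_; _≐_; _⊥_; ∅)

Monotone : {X : Set} → (Pred X 0ℓ → Pred X 0ℓ) → Set₁
Monotone F = ∀ {I J} → I ⊆ J → F I ⊆ F J

record IsLeastFixpoint {X : Set} (F : Pred X 0ℓ → Pred X 0ℓ) (I : Pred X 0ℓ) : Set₁ where
  field
    fixpoint : F I ≐ I
    least    : ∀ J → F J ≐ J → I ⊆ J

-- The intersection of all pre-fixpoints quantifies over Pred X 0ℓ and so
-- lives in Set₁; excluded middle replaces it by an equivalent proposition
-- in Set, so that F applies to its own least fixpoint.
module _ (em : ExcludedMiddle (lsuc 0ℓ)) {X : Set} (F : Pred X 0ℓ → Pred X 0ℓ) where

  lfp : Pred X 0ℓ
  lfp x = True (em {∀ (I : Pred X 0ℓ) → F I ⊆ I → x ∈ I})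

  lfp-isLeastFixpoint : Monotone F → IsLeastFixpoint F lfp
  lfp-isLeastFixpoint mono = record
    { fixpoint = pre , λ x∈ → toWitness x∈ (F lfp) (mono pre)
    ; least    = λ J (FJ⊆J , _) → lower FJ⊆J
    }
    where
    lower : ∀ {I} → F I ⊆ I → lfp ⊆ I
    lower FI⊆I x∈ = toWitness x∈ _ FI⊆I

    pre : F lfp ⊆ lfp
    pre x∈ = fromWitness λ I FI⊆I → FI⊆I (mono (lower FI⊆I) x∈)

data ObjLit (Atom : Set) : Set where
  pos neg : Atom → ObjLit Atom

infix 8 ~_

~_ : {Atom : Set} → ObjLit Atom → ObjLit Atom
~ pos B = neg B
~ neg B = pos B

atom : {Atom : Set} → ObjLit Atom → Atom
atom (pos B) = B
atom (neg B) = B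

data Literal (Atom : Set) : Set where
  obj : ObjLit Atom → Literal Atom
  not : ObjLit Atom → Literal Atom

-- The rule  L₀ ← L₁,…,Lₘ, not Lₘ₊₁,…, not Lₘ₊ₙ  has head L₀,
-- body⁺ L₁,…,Lₘ and body⁻ Lₘ₊₁,…,Lₘ₊ₙ.
record Rule (Atom : Set) : Set where
  constructor rule
  field
    head  : ObjLit Atom
    body⁺ : List (ObjLit Atom)
    body⁻ : List (ObjLit Atom)

open Rule public

Program : Set → Set₁
Program Atom = Pred (Rule Atom) 0ℓ

infix 6 _∪not_

_∪not_ : {Atom : Set} → Pred (ObjLit Atom) 0ℓ → Pred (ObjLit Atom) 0ℓ →
         Pred (Literal Atom) 0ℓ
(T ∪not F) (obj L) = L ∈ T
(T ∪not F) (not L) = L ∈ F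

module _ {Atom : Set} (P : Program Atom) where

  -- The literals over the atoms occurring in P: both B and ¬B belong to
  -- the Herbrand base as soon as one of them occurs in P.
  ℋ : Pred (ObjLit Atom) 0ℓ
  ℋ L = ∃[ r ] r ∈ P × atom L ∈ˡ map atom (head r ∷ body⁺ r ++ body⁻ r)

  PseudoInterpretation : Pred (Literal Atom) 0ℓ → Set
  PseudoInterpretation M = M ∘ obj ⊆ ℋ × M ∘ not ⊆ ℋ

  Interpretation : Pred (Literal Atom) 0ℓ → Set
  Interpretation M = PseudoInterpretation M × (M ∘ obj) ⊥ (M ∘ not)

module _ {Atom : Set} where

  conc : List (Rule Atom) → Pred (ObjLit Atom) 0ℓ
  conc A L = Any (λ r → head r ≡ L) A

  assm : List (Rule Atom) → Pred (Literal Atom) 0ℓ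
  assm A = ∅ ∪not λ L → Any (λ r → L ∈ˡ body⁻ r) A

  Undercuts Rebuts Attacks : Rel (List (Rule Atom)) 0ℓ
  Undercuts A₁ A₂ = ∃[ L ] L ∈ conc A₁ × not L ∈ assm A₂
  Rebuts    A₁ A₂ = ∃[ L ] L ∈ conc A₁ × ~ L ∈ conc A₂
  Attacks   A₁ A₂ = Undercuts A₁ A₂ ⊎ Rebuts A₁ A₂

module _ {Atom : Set} (P : Program Atom) where

  IsArgument : Pred (List (Rule Atom)) 0ℓ
  IsArgument A =
    All P A ×
    (∀ (i : Fin (length A)) {L} → L ∈ˡ body⁺ (lookup A i) →
      ∃[ k ] i Fin.< k × head (lookup A k) ≡ L)

  MinimalFor : ObjLit Atom → Pred (List (Rule Atom)) 0ℓ
  MinimalFor L A = L ∈ conc A × (∀ {A′} → A′ ⊏ A → IsArgument A′ → L ∉ conc A′)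

  Args : Set
  Args = Σ[ A ∈ List (Rule Atom) ] IsArgument A × (∃[ L ] MinimalFor L A)

  module _ (x y : Rel (List (Rule Atom)) 0ℓ) where

    Acceptable : Pred Args 0ℓ → Pred Args 0ℓ
    Acceptable S A =
      ∀ B → (x on proj₁) B A → ∃[ C ] C ∈ S × (y on proj₁) C B

    Acceptable-mono : Monotone Acceptable
    Acceptable-mono S⊆S′ acc B xBA with acc B xBA
    ... | C , C∈S , yCB = C , S⊆S′ C∈S , yCB

DefiniteProgram : Set → Set₁
DefiniteProgram X = Pred (X × List X) 0ℓ

IsModel : {X : Set} → DefiniteProgram X → Pred X 0ℓ → Set
IsModel D M = ∀ {h b} → (h , b) ∈ D → All M b → h ∈ M

data LeastModel {X : Set} (D : DefiniteProgram X) : Pred X 0ℓ where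
  derive : ∀ {h b} → (h , b) ∈ D → All (LeastModel D) b → LeastModel D h

LeastModel-isModel : {X : Set} (D : DefiniteProgram X) → IsModel D (LeastModel D)
LeastModel-isModel D = derive

module _ {X : Set} (D : DefiniteProgram X) {M : Pred X 0ℓ} (model : IsModel D M) where

  LeastModel-least : LeastModel D ⊆ M
  LeastModel-least-all : ∀ {b} → All (LeastModel D) b → All M b

  LeastModel-least (derive r∈D ds) = model r∈D (LeastModel-least-all ds)

  LeastModel-least-all []       = []
  LeastModel-least-all (d ∷ ds) = LeastModel-least d ∷ LeastModel-least-all ds

module _ {Atom : Set} where

  -- Objective literals serve as the atoms of the definite program, so pos B
  -- and neg B are unrelated there.
  reduct : Program Atom → Pred (ObjLit Atom) 0ℓ → DefiniteProgram (ObjLit Atom)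
  reduct P I (h , b) = ∃[ n ] rule h b n ∈ P × ¬ Any I n

  Γ : Program Atom → Pred (ObjLit Atom) 0ℓ → Pred (ObjLit Atom) 0ℓ
  Γ P I = LeastModel (reduct P I)

  semiNormalRule : Rule Atom → Rule Atom
  semiNormalRule (rule L b n) = rule L b (~ L ∷ n)

  semiNormal : Program Atom → Program Atom
  semiNormal P r = ∃[ r′ ] r′ ∈ P × r ≡ semiNormalRule r′

  Γₛ : Program Atom → Pred (ObjLit Atom) 0ℓ → Pred (ObjLit Atom) 0ℓ
  Γₛ P = Γ (semiNormal P)

  Γ-antitone : ∀ P {I J} → I ⊆ J → Γ P J ⊆ Γ P I
  Γ-antitone P I⊆J = LeastModel-least _
    λ (n , r∈P , ¬J) → derive (n , r∈P , λ i → ¬J (Any.map I⊆J i))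

  ΓΓₛ-mono : ∀ P → Monotone (Γ P ∘ Γₛ P)
  ΓΓₛ-mono P I⊆J = Γ-antitone P (Γ-antitone (semiNormal P) I⊆J)

module _ (em : ExcludedMiddle (lsuc 0ℓ)) {Atom : Set} (P : Program Atom) where

  Justified : Pred (Args P) 0ℓ
  Justified = lfp em (Acceptable P Undercuts Attacks)

  Overruled : Pred (Args P) 0ℓ
  Overruled A = ∃[ C ] C ∈ Justified × (Attacks on proj₁) C A

  ArgSem : Pred (Literal Atom) 0ℓ
  ArgSem = T ∪not F
    where
    T F : Pred (ObjLit Atom) 0ℓ
    T L = L ∈ ℋ P × (∃[ A ] L ∈ conc (proj₁ A) × A ∈ Justified)
    F L = L ∈ ℋ P × (∀ A → L ∈ conc (proj₁ A) → A ∈ Overruled)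

  WFMₚ : Pred (Literal Atom) 0ℓ
  WFMₚ = T ∪not (λ L → L ∈ ℋ P × L ∉ Γₛ P T)
    where
    T : Pred (ObjLit Atom) 0ℓ
    T = lfp em (Γ P ∘ Γₛ P)

  NonContradictory : Set
  NonContradictory = Interpretation P WFMₚ

  WFM : NonContradictory → Pred (Literal Atom) 0ℓ
  WFM _ = WFMₚ

{-# OPTIONS --safe #-}

-- A literal is derivable from a definite program iff it is the conclusion of
-- an argument built from rules with the same heads and positive bodies.
-- Let I be the set of conclusions of a set S of arguments.  Then Γₛ I consists
-- of the conclusions of the arguments that S does not attack: the default
-- literal added by the semi-normal version accounts for the rebuts, the others
-- for the undercuts.  Hence A is acceptable wrt. S iff no assumption of A is in
-- Γₛ I, and so the conclusions of the acceptable arguments form Γ (Γₛ I).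
-- Taking conclusions therefore carries the least fixpoint of the acceptability
-- operator to that of ΓΓₛ.
module Submission where

open import Axiom.ExcludedMiddle using (ExcludedMiddle)
open import Data.Fin as Fin using (Fin; zero; suc)
open import Data.List using (List; []; _∷_; _++_; length; lookup)
open import Data.List.Membership.Propositional using (find; lose) renaming (_∈_ to _∈ˡ_)
open import Data.List.Membership.Propositional.Properties using (∈-lookup)
open import Data.List.Relation.Binary.Sublist.Propositional using (⊆-refl; ⊆-trans)
  renaming (_⊆_ to _⊑_; _⊂_ to _⊏_)
open import Data.List.Relation.Binary.Sublist.Propositional.Properties
  using (All-resp-⊆; length-mono-≤; to-≋)
open import Data.List.Relation.Unary.All as All using (All; []; _∷_)
import Data.List.Relation.Unary.All.Properties as All
open import Data.List.Relation.Unary.Any as Any using (Any; here; there)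
open import Data.List.Relation.Unary.Any.Properties using (++⁺ˡ; ++⁺ʳ; lookup-result)
open import Data.Nat using (_<_; z<s; s<s; s<s⁻¹)
open import Data.Nat.Induction using (<-wellFounded)
open import Data.Nat.Properties using (≤∧≢⇒<)
open import Data.Product using (∃-syntax; _×_; _,_; proj₁; proj₂)
open import Data.Sum using (inj₁; inj₂)
open import Function using (_∘_; _on_)
open import Induction.WellFounded using (Acc; acc)
open import Level using (lift; lower; 0ℓ) renaming (suc to lsuc)
open import Relation.Binary.PropositionalEquality using (_≡_; refl; sym; trans; cong; subst)
open import Relation.Nullary using (¬_; yes; no)
open import Relation.Nullary.Decidable using (map′; decidable-stable)
open import Relation.Unary using (Pred; _∈_; _∉_; _⊆_; _≐_; _∩_)
open import Defs

⊏⇒length< : {X : Set} {xs ys : List X} → xs ⊏ ys → length xs < length ys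
⊏⇒length< (xs⊑ys , xs≉ys) =
  ≤∧≢⇒< (length-mono-≤ xs⊑ys) λ eq → xs≉ys (to-≋ eq xs⊑ys)

~-involutive : {Atom : Set} (L : ObjLit Atom) → ~ ~ L ≡ L
~-involutive (pos B) = refl
~-involutive (neg B) = refl

module _ {Atom : Set} {P : Program Atom} where

  []-argument : IsArgument P []
  []-argument = [] , λ ()

  ∷-argument : ∀ {r A} → r ∈ P → All (conc A) (body⁺ r) → IsArgument P A →
               IsArgument P (r ∷ A)
  ∷-argument {r} {A} r∈P supported (A⊆P , closed) = r∈P ∷ A⊆P , closed′
    where
    closed′ : ∀ i {L} → L ∈ˡ body⁺ (lookup (r ∷ A) i) →
              ∃[ k ] i Fin.< k × head (lookup (r ∷ A) k) ≡ L
    closed′ zero L∈ = let a = All.lookup supported L∈ in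
      suc (Any.index a) , z<s , lookup-result a
    closed′ (suc i) L∈ with closed i L∈
    ... | k , i<k , eq = suc k , s<s i<k , eq

  argument-tail : ∀ {r A} → IsArgument P (r ∷ A) → IsArgument P A
  argument-tail (_ ∷ A⊆P , closed) = A⊆P , λ i L∈ → pred (closed (suc i) L∈)
    where
    pred : ∀ {r A L} {i : Fin (length A)} →
           ∃[ k ] suc i Fin.< k × head (lookup (r ∷ A) k) ≡ L →
           ∃[ k ] i Fin.< k × head (lookup A k) ≡ L
    pred (suc k , i<k , eq) = k , s<s⁻¹ i<k , eq

  argument-supported : ∀ {r A} → IsArgument P (r ∷ A) → All (conc A) (body⁺ r)
  argument-supported {r} {A} (_ , closed) = All.tabulate λ L∈ → supported (closed zero L∈)
    where
    supported : ∀ {L} → ∃[ k ] zero {length A} Fin.< k × head (lookup (r ∷ A) k) ≡ L →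
                L ∈ conc A
    supported (suc k , _ , eq) = lose (∈-lookup k) eq

  ++-argument : ∀ {A B} → IsArgument P A → IsArgument P B → IsArgument P (A ++ B)
  ++-argument {[]}    arg argB = argB
  ++-argument {r ∷ A} arg argB =
    ∷-argument (All.head (proj₁ arg)) (All.map ++⁺ˡ (argument-supported arg))
               (++-argument (argument-tail arg) argB)

module _ {Atom : Set} {D : DefiniteProgram (ObjLit Atom)} {Q : Program Atom} where

  module _ (D⇒Q : ∀ {h b} → (h , b) ∈ D → ∃[ n ] rule h b n ∈ Q) where

    -- A derivation is flattened root first, followed by the arguments for its premises, so that
    -- support always comes later. `Q` is separate from `D` because a reduct forgets the negative
    -- bodies, and because the reduct of `semiNormal P` is to be matched with rules of `P` itself.
    leastModel⇒argument : ∀ {L} → L ∈ LeastModel D → ∃[ A ] IsArgument Q A × L ∈ conc A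
    leastModel⇒arguments : ∀ {Ls} → All (LeastModel D) Ls →
                           ∃[ A ] IsArgument Q A × All (conc A) Ls

    leastModel⇒argument (derive d ms) with D⇒Q d | leastModel⇒arguments ms
    ... | n , r∈Q | A , arg , supported =
      rule _ _ n ∷ A , ∷-argument r∈Q supported arg , here refl

    leastModel⇒arguments []       = [] , []-argument , []
    leastModel⇒arguments (m ∷ ms) with leastModel⇒argument m | leastModel⇒arguments ms
    ... | A , argA , L∈A | B , argB , Ls⊆B =
      A ++ B , ++-argument argA argB , ++⁺ˡ L∈A ∷ All.map (++⁺ʳ A) Ls⊆B

  -- Support lies strictly later in the sequence, so the tail is again an argument and supplies the
  -- positive body of the first rule: induction on the list.
  argument⇒leastModel : (∀ {r} → r ∈ Q → (head r , body⁺ r) ∈ D) →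
                        ∀ {A} → IsArgument Q A → conc A ⊆ LeastModel D
  argument⇒leastModel Q⇒D arg@(r∈Q ∷ _ , _) (here refl) =
    derive (Q⇒D r∈Q)
      (All.map (argument⇒leastModel Q⇒D (argument-tail arg)) (argument-supported arg))
  argument⇒leastModel Q⇒D arg (there L∈A) = argument⇒leastModel Q⇒D (argument-tail arg) L∈A

module _ {Atom : Set} (P : Program Atom) where

  -- The condition for a rule to survive the reduct by `I`. Being imposed on each rule separately,
  -- it passes to subarguments and can be absorbed into the program as `P ∩ Unblocked I`.
  Unblocked : Pred (ObjLit Atom) 0ℓ → Pred (Rule Atom) 0ℓ
  Unblocked I r = ¬ Any I (body⁻ r)

  Conclusions : Pred (Args P) 0ℓ → Pred (ObjLit Atom) 0ℓ
  Conclusions S L = ∃[ A ] L ∈ conc (proj₁ A) × A ∈ S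

  Attacked : Pred (Args P) 0ℓ → Pred (Args P) 0ℓ
  Attacked S B = ∃[ C ] C ∈ S × (Attacks on proj₁) C B

  Conclusions-mono : ∀ {S S′} → S ⊆ S′ → Conclusions S ⊆ Conclusions S′
  Conclusions-mono S⊆S′ (A , L∈A , A∈S) = A , L∈A , S⊆S′ A∈S

  unattacked⇒unblocked : ∀ {S} B → B ∉ Attacked S →
                         All (Unblocked (Conclusions S) ∘ semiNormalRule) (proj₁ B)
  unattacked⇒unblocked {S} B ¬att = All.tabulate unblocked
    where
    unblocked : ∀ {r} → r ∈ˡ proj₁ B → Unblocked (Conclusions S) (semiNormalRule r)
    -- `Rebuts` looks in `B` for the complement of the conclusion `~ head r` of `C`, hence the
    -- double complement.
    unblocked {r} r∈B (here (C , L∈C , C∈S)) =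
      ¬att (C , C∈S , inj₂ (~ head r , L∈C , lose r∈B (sym (~-involutive (head r)))))
    unblocked r∈B (there blocked) =
      let M , M∈r , C , M∈C , C∈S = find blocked
      in ¬att (C , C∈S , inj₁ (M , M∈C , lose r∈B M∈r))

  unblocked⇒unattacked : ∀ {S} B →
                         All (Unblocked (Conclusions S) ∘ semiNormalRule) (proj₁ B) →
                         B ∉ Attacked S
  unblocked⇒unattacked B unbl (C , C∈S , inj₁ (M , M∈C , M∈assm)) =
    let r , r∈B , M∈r = find M∈assm
    in All.lookup unbl r∈B (there (lose M∈r (C , M∈C , C∈S)))
  unblocked⇒unattacked B unbl (C , C∈S , inj₂ (L , L∈C , ~L∈B)) =
    let r , r∈B , eq = find ~L∈B
        L≡ = trans (sym (~-involutive L)) (cong ~_ (sym eq))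
    in All.lookup unbl r∈B (here (C , subst (_∈ conc (proj₁ C)) L≡ L∈C , C∈S))

  args⇒Γ : ∀ {I} (A : Args P) → All (Unblocked I) (proj₁ A) → conc (proj₁ A) ⊆ Γ P I
  args⇒Γ (A , (A⊆P , closed) , _) unbl =
    argument⇒leastModel {Q = P ∩ Unblocked _} (λ (r∈P , u) → _ , r∈P , u)
      (All.zip (A⊆P , unbl) , closed)

  -- `semiNormalRule` changes neither head nor positive body, so the argument stays one over `P` and
  -- only the condition on its rules mentions the semi-normal version.
  args⇒Γₛ : ∀ {I} (A : Args P) → All (Unblocked I ∘ semiNormalRule) (proj₁ A) →
            conc (proj₁ A) ⊆ Γₛ P I
  args⇒Γₛ (A , (A⊆P , closed) , _) unbl =
    argument⇒leastModel {Q = P ∩ (Unblocked _ ∘ semiNormalRule)}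
      (λ (r∈P , u) → _ , (_ , r∈P , refl) , u)
      (All.zip (A⊆P , unbl) , closed)

  module _ (em : ExcludedMiddle (lsuc 0ℓ)) where

    em₀ : ExcludedMiddle 0ℓ
    em₀ = map′ lower lift em

    -- Flattened derivations need not be minimal, whereas `Args P` admits only minimal arguments.
    -- Passing to a proper subargument for `L` shortens the list, so this terminates; `B ⊑ A` is
    -- recorded to transfer conditions on rules from `A` to `B`.
    minimise : ∀ {L} A → Acc _<_ (length A) → IsArgument P A → L ∈ conc A →
               ∃[ B ] B ⊑ A × IsArgument P B × MinimalFor P L B
    minimise {L} A (acc rs) argA L∈A
      with em₀ {∃[ B ] B ⊏ A × IsArgument P B × L ∈ conc B}
    ... | no ¬smaller =
      A , ⊆-refl , argA , L∈A , λ B⊏A argB L∈B → ¬smaller (_ , B⊏A , argB , L∈B)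
    ... | yes (B , B⊏A , argB , L∈B) with minimise B (rs (⊏⇒length< B⊏A)) argB L∈B
    ...   | C , C⊑B , C-minimal = C , ⊆-trans C⊑B (proj₁ B⊏A) , C-minimal

    leastModel⇒args : ∀ {D U} → (∀ {h b} → (h , b) ∈ D → ∃[ n ] rule h b n ∈ P ∩ U) →
                      LeastModel D ⊆ Conclusions (All U ∘ proj₁)
    leastModel⇒args {U = U} D⇒P L∈ with leastModel⇒argument {Q = P ∩ U} D⇒P L∈
    ... | A , (A⊆P∩U , closed) , L∈A
      -- Minimality is required among arguments over `P`, so `U` is dropped here and recovered
      -- afterwards along the sublist.
      with minimise A (<-wellFounded _) (All.map proj₁ A⊆P∩U , closed) L∈A
    ...   | B , B⊑A , argB , L∈B , minimal =
      (B , argB , _ , L∈B , minimal) , L∈B , All-resp-⊆ B⊑A (All.map proj₂ A⊆P∩U)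

    Γ⇒args : ∀ {I} → Γ P I ⊆ Conclusions (All (Unblocked I) ∘ proj₁)
    Γ⇒args = leastModel⇒args λ d → d

    Γₛ⇒args : ∀ {I} → Γₛ P I ⊆ Conclusions (All (Unblocked I ∘ semiNormalRule) ∘ proj₁)
    Γₛ⇒args = leastModel⇒args λ where
      (_ , (rule _ _ n , r∈P , refl) , u) → n , r∈P , u

    acceptable⇒unblocked : ∀ {S} A → A ∈ Acceptable P Undercuts Attacks S →
                           All (Unblocked (Γₛ P (Conclusions S))) (proj₁ A)
    acceptable⇒unblocked A acceptable = All.tabulate λ r∈A blocked →
      let M , M∈r , M∈Γₛ = find blocked
          B , M∈B , unbl = Γₛ⇒args M∈Γₛ
      in unblocked⇒unattacked B unbl (acceptable B (M , M∈B , lose r∈A M∈r))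

    -- If `S` left an undercutter `B` unattacked, the conclusion `M` by which it undercuts `A` would
    -- lie in Γₛ and block a rule of `A`. The attacker itself is obtained classically.
    unblocked⇒acceptable : ∀ {S} A → All (Unblocked (Γₛ P (Conclusions S))) (proj₁ A) →
                           A ∈ Acceptable P Undercuts Attacks S
    unblocked⇒acceptable A unbl B (M , M∈B , M∈assm) =
      decidable-stable em₀ λ ¬att →
        let r , r∈A , M∈r = find M∈assm
        in All.lookup unbl r∈A (lose M∈r (args⇒Γₛ B (unattacked⇒unblocked B ¬att) M∈B))

    Conclusions-acceptable : ∀ S → Conclusions (Acceptable P Undercuts Attacks S) ≐
                                   Γ P (Γₛ P (Conclusions S))
    Conclusions-acceptable S =
      (λ (A , L∈A , acceptable) → args⇒Γ A (acceptable⇒unblocked A acceptable) L∈A) ,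
      (λ L∈ → let A , L∈A , unbl = Γ⇒args L∈ in A , L∈A , unblocked⇒acceptable A unbl)

    private
      T : Pred (ObjLit Atom) 0ℓ
      T = lfp em (Γ P ∘ Γₛ P)

      J : Pred (Args P) 0ℓ
      J = Justified em P

    open IsLeastFixpoint (lfp-isLeastFixpoint em (Γ P ∘ Γₛ P) (ΓΓₛ-mono P))
      renaming (fixpoint to T-fixpoint; least to T-least)
    open IsLeastFixpoint (lfp-isLeastFixpoint em (Acceptable P Undercuts Attacks)
                           (Acceptable-mono P Undercuts Attacks))
      renaming (fixpoint to J-fixpoint; least to J-least)

    -- `J` is a fixpoint of acceptability, so its conclusions form a fixpoint of ΓΓₛ, and `T` is the
    -- least one.
    T⊆Conclusions-J : T ⊆ Conclusions J
    T⊆Conclusions-J = T-least (Conclusions J)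
      ( Conclusions-mono (proj₁ J-fixpoint) ∘ proj₂ (Conclusions-acceptable J)
      , proj₁ (Conclusions-acceptable J) ∘ Conclusions-mono (proj₂ J-fixpoint))

    -- Leastness of `J` calls for a fixpoint made of arguments whose conclusions are `T`. The
    -- arguments without assumptions blocked by `Γₛ P T` serve: their conclusions form ΓΓₛ `T`,
    -- which is `T`.
    Conclusions-J⊆T : Conclusions J ⊆ T
    Conclusions-J⊆T = Conclusions-S⊆T ∘ Conclusions-mono (J-least S S-fixpoint)
      where
      S : Pred (Args P) 0ℓ
      S = All (Unblocked (Γₛ P T)) ∘ proj₁

      Conclusions-S⊆T : Conclusions S ⊆ T
      Conclusions-S⊆T (A , L∈A , unbl) = proj₁ T-fixpoint (args⇒Γ A unbl L∈A)

      T⊆Conclusions-S : T ⊆ Conclusions S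
      T⊆Conclusions-S = Γ⇒args ∘ proj₂ T-fixpoint

      Γₛ-Conclusions-S≐Γₛ-T : Γₛ P (Conclusions S) ≐ Γₛ P T
      Γₛ-Conclusions-S≐Γₛ-T =
        Γ-antitone (semiNormal P) T⊆Conclusions-S , Γ-antitone (semiNormal P) Conclusions-S⊆T

      -- Acceptability wrt. `S` depends on `S` only through Γₛ of its conclusions, which here is
      -- `Γₛ P T`, the very set that defines `S`.
      S-fixpoint : Acceptable P Undercuts Attacks S ≐ S
      S-fixpoint =
        (λ {A} → All.map (_∘ Any.map (proj₂ Γₛ-Conclusions-S≐Γₛ-T)) ∘ acceptable⇒unblocked A) ,
        (λ {A} → unblocked⇒acceptable A ∘ All.map (_∘ Any.map (proj₁ Γₛ-Conclusions-S≐Γₛ-T)))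

    ∉Γₛ⇒overruled : ∀ {L} → L ∉ Γₛ P T → ∀ A → L ∈ conc (proj₁ A) → A ∈ Overruled em P
    ∉Γₛ⇒overruled L∉ A L∈A = decidable-stable em₀ λ ¬att →
      L∉ (Γ-antitone (semiNormal P) T⊆Conclusions-J
            (args⇒Γₛ A (unattacked⇒unblocked A ¬att) L∈A))

    overruled⇒∉Γₛ : ∀ {L} → (∀ A → L ∈ conc (proj₁ A) → A ∈ Overruled em P) → L ∉ Γₛ P T
    overruled⇒∉Γₛ overruled L∈Γₛ =
      let A , L∈A , unbl = Γₛ⇒args (Γ-antitone (semiNormal P) Conclusions-J⊆T L∈Γₛ)
      in unblocked⇒unattacked A unbl (overruled A L∈A)

corollary12 : (em : ExcludedMiddle (lsuc 0ℓ)) {Atom : Set} (P : Program Atom) →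
    (nc : NonContradictory em P) → WFM em P nc ≐ ArgSem em P
corollary12 em P nc@((T⊆ℋ , _) , _) = (λ {l} → WFM⊆ArgSem l) , (λ {l} → ArgSem⊆WFM l)
  where
  WFM⊆ArgSem : ∀ l → l ∈ WFM em P nc → l ∈ ArgSem em P
  -- `ArgSem` demands membership in the Herbrand base; `nc` provides it, as it makes the model a
  -- pseudo-interpretation.
  WFM⊆ArgSem (obj L) L∈T        = T⊆ℋ L∈T , T⊆Conclusions-J P em L∈T
  WFM⊆ArgSem (not L) (L∈ℋ , L∉) = L∈ℋ , ∉Γₛ⇒overruled P em L∉

  ArgSem⊆WFM : ∀ l → l ∈ ArgSem em P → l ∈ WFM em P nc
  ArgSem⊆WFM (obj L) (_ , L∈J)         = Conclusions-J⊆T P em L∈J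
  ArgSem⊆WFM (not L) (L∈ℋ , overruled) = L∈ℋ , overruled⇒∉Γₛ P em overruled
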